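{- Let $\mathbb{O} = (n, \mathbb{O}^+, \mathbb{O}^-)$ be any orientation, i.e. $\mathbb{O}^+, \mathbb{O}^- \subseteq [n]$ arbitrary, and let $\varepsilon \in \{\varnothing, -, +, \pm\}$. Then the set $\mathsf{IPIP}^{\varepsilon}(\mathbb{O}) \cap \mathsf{WOIP}(n)$ (resp. $\mathsf{DPIP}^{\varepsilon}(\mathbb{O}) \cap \mathsf{WOIP}(n)$) induces a sublattice of the lattice $(\mathsf{WOIP}(n), \preccurlyeq, \wedge_{\mathsf{WOIP}}, \vee_{\mathsf{WOIP}})$.
   Context: $[n] = \{1,\dots,n\}$; $\mathcal{P}(n)$ is the set of (reflexive) posets on $[n]$. For a poset $\vartriangleleft$, $a \vartriangleright b$ means $b \vartriangleleft a$; let ${\vartriangleleft}^{\mathsf{Inc}} = \{(a,b) : a\le b,\ a \vartriangleleft b\}$ and ${\vartriangleleft}^{\mathsf{Dec}} = \{(b,a) : a\le b,\ b \vartriangleleft a\}$. The weak order on $\mathcal{P}(n)$ is ${\vartriangleleft} \preccurlyeq {\blacktriangleleft}$ iff ${\vartriangleleft}^{\mathsf{Inc}} \supseteq {\blacktriangleleft}^{\mathsf{Inc}}$ and ${\vartriangleleft}^{\mathsf{Dec}} \subseteq {\blacktriangleleft}^{\mathsf{Dec}}$. A permutation $\sigma \in \mathfrak{S}(n)$ gives the total order $\vartriangleleft_\sigma$ with $u \vartriangleleft_\sigma v$ iff $\sigma^{ -1}(u) \le \sigma^{ -1}(v)$. The weak order on $\mathfrak{S}(n)$ is: $\sigma \preccurlyeq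 \tau$ iff every pair $a<b$ with $\sigma^{ -1}(a)>\sigma^{ -1}(b)$ also satisfies $\tau^{ -1}(a)>\tau^{ -1}(b)$; it is a lattice with meet $\wedge_{\mathfrak{S}}$ and join $\vee_{\mathfrak{S}}$. A linear extension of $\vartriangleleft$ is a permutation $\sigma$ with ${\vartriangleleft} \subseteq {\vartriangleleft_\sigma}$; a weak order maximal (minimal) linear extension means one that is greatest (least) in weak order among all linear extensions. For $\sigma \preccurlyeq \sigma'$ let ${\vartriangleleft_{[\sigma,\sigma']}} = {\vartriangleleft_\sigma} \cap {\vartriangleleft_{\sigma'}}$, and $\mathsf{WOIP}(n) = \{{\vartriangleleft_{[\sigma,\sigma']}} : \sigma \preccurlyeq \sigma'\}$. Under the weak order $\preccurlyeq$ on posets, $\mathsf{WOIP}(n)$ is a lattice with ${\vartriangleleft_{[\sigma,\sigma']}} \wedge_{\mathsf{WOIP}} {\vartriangleleft_{[\tau,\tau']}} = {\vartriangleleft_{[\sigma \wedge_{\mathfrak{S}} \tau,\, \sigma' \wedge_{\mathfrak{S}} \tau']}}$ and ${\vartriangleleft_{[\sigma,\sigma']}} \vee_{\mathsf{WOIP}} {\vartriangleleft_{[\tau,\tau']}} = {\vartriangleleft_{[\sigma \vee_{\mathfrak{S}} \tau,\, \sigma' \vee_{\mathfrak{S}} \tau']}}$. A subset induces a sublattice if it is closed under this meet and join. $\mathsf{IPIP}^{+}(\mathbb{O}) = \{{\vartriangleleft} \in \mathcal{P}(n) : \forall a<b<c \text{ with } b \in \mathbb{O}^+,\ a \vartriangleleft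 c \Rightarrow a \vartriangleleft b\}$; $\mathsf{IPIP}^{ - }(\mathbb{O}) = \{{\vartriangleleft} \in \mathcal{P}(n) : \forall a<b<c \text{ with } b \in \mathbb{O}^-,\ a \vartriangleleft c \Rightarrow b \vartriangleleft c\}$; $\mathsf{IPIP}^{\pm}(\mathbb{O}) = \mathsf{IPIP}^{+}(\mathbb{O}) \cap \mathsf{IPIP}^{ - }(\mathbb{O})$; $\mathsf{DPIP}^{+}(\mathbb{O}) = \{{\vartriangleleft} \in \mathcal{P}(n) : \forall a<b<c \text{ with } b \in \mathbb{O}^+,\ a \vartriangleright c \Rightarrow b \vartriangleright c\}$; $\mathsf{DPIP}^{ - }(\mathbb{O}) = \{{\vartriangleleft} \in \mathcal{P}(n) : \forall a<b<c \text{ with } b \in \mathbb{O}^-,\ a \vartriangleright c \Rightarrow a \vartriangleright b\}$; $\mathsf{DPIP}^{\pm}(\mathbb{O}) = \mathsf{DPIP}^{+}(\mathbb{O}) \cap \mathsf{DPIP}^{ - }(\mathbb{O})$. For $\varepsilon = \varnothing$: $\mathsf{IPIP}^{\varnothing}(\mathbb{O}) = \mathsf{IPIP}(\mathbb{O})$ is the set of posets in $\mathcal{P}(n)$ that admit a weak order maximal linear extension in which there are no $a<b<c$ such that $b \in \mathbb{O}^+$ and the values $b,a,c$ appear in this order from left to right, and no $a<b<c$ such that $b \in \mathbb{O}^-$ and $a,c,b$ appear in this order; $\mathsf{DPIP}^{\varnothing}(\mathbb{O}) = \mathsf{DPIP}(\mathbb{O})$ is the set of posets in $\mathcal{P}(n)$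 that admit a weak order minimal linear extension in which there are no $a<b<c$ such that $b \in \mathbb{O}^+$ and $b,c,a$ appear in this order, and no $a<b<c$ such that $b \in \mathbb{O}^-$ and $c,a,b$ appear in this order. -}

module Defs where

open import Algebra.Core using (Op₂)
open import Data.Fin.Base using (Fin; fromℕ<; punchOut; _≤_; _<_; _>_)
open import Data.Fin.Induction using (>-wellFounded)
open import Data.Fin.Permutation using (Permutation′; permutation; _⟨$⟩ʳ_; _⟨$⟩ˡ_; inverseʳ)
open import Data.Fin.Properties using (_≟_; _≤?_; _<?_; ≤-refl; ≤-trans; ≤-antisym; ≤-total; ≤-reflexive; <-trans; <-cmp; <-irrefl; <-asym; <⇒≢; ≤∧≢⇒<; any?; injective⇒≤; punchOut-injective; toℕ-fromℕ<)
open import Data.Fin.Subset using (Subset; _∈_; ∣_∣; ⊤)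
open import Data.Fin.Subset.Properties using (p⊂q⇒∣p∣<∣q∣; ⊆⊤; ∈⊤; ∣⊤∣≡n)
open import Data.Nat.Base as ℕ using (ℕ; suc)
import Data.Nat.Properties as ℕ
open import Data.Product.Base using (_×_; _,_; proj₁; proj₂; ∃; ∃-syntax)
open import Data.Sum.Base as Sum using (_⊎_; inj₁; inj₂; [_,_]′)
open import Data.Vec.Base using (tabulate)
open import Data.Vec.Properties using (lookup∘tabulate; lookup⇒[]=; []=⇒lookup)
open import Function.Base using (flip; _∘_)
open import Function.Bundles using (_⇔_; mk⇔; module Equivalence)
open import Induction.WellFounded using (Acc; acc)
open import Level using (0ℓ; _⊔_) renaming (suc to lsuc)
open import Relation.Binary.Core using (Rel; _⇒_)
open import Relation.Binary.Construct.Closure.Transitive as Plus using (TransClosure; [_]; _∷_)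
import Relation.Binary.Construct.Flip.EqAndOrd as Flip
open import Relation.Binary.Definitions using (Decidable; Transitive; Trichotomous; Tri; tri<; tri≈; tri>)
open import Relation.Binary.Lattice.Bundles using (Lattice)
open import Relation.Binary.Lattice.Definitions using (Supremum; Infimum)
open import Relation.Binary.PropositionalEquality using (_≡_; refl; sym; trans; cong; subst; subst₂; isEquivalence; resp₂)
open import Relation.Binary.Structures using (IsDecPartialOrder; IsStrictTotalOrder)
open import Relation.Nullary using (Dec; yes; no; does; ¬_; contradiction)
open import Relation.Nullary.Decidable using (_×-dec_; _⊎-dec_; dec-true)
open import Relation.Unary using (Pred; _∩_)

private
  variable
    n : ℕ

-- [n] is represented by Fin n.
record 𝒫 (n : ℕ) : Set₁ where
  field
    _◁_               : Rel (Fin n) 0ℓ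
    isDecPartialOrder : IsDecPartialOrder _≡_ _◁_

open 𝒫 public using (isDecPartialOrder)

infix 4 _⊢_◁_ _⊢_▷_

_⊢_◁_ : 𝒫 n → Rel (Fin n) 0ℓ
p ⊢ a ◁ b = 𝒫._◁_ p a b

_⊢_▷_ : 𝒫 n → Rel (Fin n) 0ℓ
p ⊢ a ▷ b = p ⊢ b ◁ a

infix 4 _≈_ _≼_

_≈_ : Rel (𝒫 n) 0ℓ
p ≈ q = ∀ a b → p ⊢ a ◁ b ⇔ q ⊢ a ◁ b

Inc : 𝒫 n → Rel (Fin n) 0ℓ
Inc p a b = a ≤ b × p ⊢ a ◁ b

-- Named to avoid a clash with the type of decisions Dec.
Dcr : 𝒫 n → Rel (Fin n) 0ℓ
Dcr p b a = a ≤ b × p ⊢ b ◁ a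

_≼_ : Rel (𝒫 n) 0ℓ
p ≼ q = (Inc q ⇒ Inc p) × (Dcr p ⇒ Dcr q)

-- σ ⟨$⟩ˡ u is σ⁻¹(u), the position of the value u in σ.
Precedes : Permutation′ n → Rel (Fin n) 0ℓ
Precedes σ u v = σ ⟨$⟩ˡ u < σ ⟨$⟩ˡ v

infix 4 _⊢_⊴_

_⊢_⊴_ : Permutation′ n → Rel (Fin n) 0ℓ
σ ⊢ u ⊴ v = σ ⟨$⟩ˡ u ≤ σ ⟨$⟩ˡ v

Inv : Permutation′ n → Rel (Fin n) 0ℓ
Inv σ a b = a < b × σ ⟨$⟩ˡ a > σ ⟨$⟩ˡ b

infix 4 _≼ₛ_

_≼ₛ_ : Rel (Permutation′ n) 0ℓ
σ ≼ₛ τ = Inv σ ⇒ Inv τ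

IsLinearExtension : 𝒫 n → Permutation′ n → Set
IsLinearExtension p σ = ∀ a b → p ⊢ a ◁ b → σ ⊢ a ⊴ b

IsMaximalLinearExtension : 𝒫 n → Permutation′ n → Set
IsMaximalLinearExtension p σ =
  IsLinearExtension p σ × (∀ τ → IsLinearExtension p τ → τ ≼ₛ σ)

IsMinimalLinearExtension : 𝒫 n → Permutation′ n → Set
IsMinimalLinearExtension p σ =
  IsLinearExtension p σ × (∀ τ → IsLinearExtension p τ → σ ≼ₛ τ)

private

  module _ {_≺_ : Rel (Fin n) 0ℓ} (sto : IsStrictTotalOrder _≡_ _≺_) where

    private module ≺ = IsStrictTotalOrder sto

    below : Fin n → Subset n
    below u = tabulate λ w → does (w ≺.<? u)

    ∈below⁺ : ∀ {w u} → w ≺ u → w ∈ below u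
    ∈below⁺ {w} {u} w≺u = lookup⇒[]= w (below u)
      (trans (lookup∘tabulate _ w) (dec-true (w ≺.<? u) w≺u))

    ∈below⁻ : ∀ {w u} → w ∈ below u → w ≺ u
    ∈below⁻ {w} {u} w∈ with w ≺.<? u | trans (sym (lookup∘tabulate (λ w → does (w ≺.<? u)) w)) ([]=⇒lookup w∈)
    ... | yes w≺u | _  = w≺u
    ... | no _    | ()

    ∣below∣<n : ∀ u → ∣ below u ∣ ℕ.< n
    ∣below∣<n u = subst (∣ below u ∣ ℕ.<_) (∣⊤∣≡n n)
      (p⊂q⇒∣p∣<∣q∣ (⊆⊤ , u , ∈⊤ , λ u∈ → ≺.irrefl refl (∈below⁻ u∈)))

    rank : Fin n → Fin n
    rank u = fromℕ< (∣below∣<n u)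

    rank-mono : ∀ {u v} → u ≺ v → rank u < rank v
    rank-mono {u} {v} u≺v =
      subst₂ ℕ._<_ (sym (toℕ-fromℕ< (∣below∣<n u))) (sym (toℕ-fromℕ< (∣below∣<n v)))
        (p⊂q⇒∣p∣<∣q∣ ( (λ w∈ → ∈below⁺ (≺.trans (∈below⁻ w∈) u≺v))
                     , u , ∈below⁺ u≺v , λ u∈ → ≺.irrefl refl (∈below⁻ u∈)))

    rank-injective : ∀ {u v} → rank u ≡ rank v → u ≡ v
    rank-injective {u} {v} eq with ≺.compare u v
    ... | tri< u≺v _ _ = contradiction (rank-mono u≺v) (<-irrefl eq)
    ... | tri≈ _ u≡v _ = u≡v
    ... | tri> _ _ v≺u = contradiction (rank-mono v≺u) (<-irrefl (sym eq))

  injective⇒surjective : (f : Fin n → Fin n) → (∀ {x y} → f x ≡ f y → x ≡ y) →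
                         ∀ y → ∃ λ x → f x ≡ y
  injective⇒surjective {suc n} f inj y with any? (λ x → f x ≟ y)
  ... | yes hit = hit
  ... | no miss = contradiction
    (injective⇒≤ {f = λ x → punchOut (≢f x)}
      (λ {x} {x′} eq → inj (punchOut-injective (≢f x) (≢f x′) eq)))
    ℕ.1+n≰n
    where
    ≢f : ∀ x → ¬ y ≡ f x
    ≢f x eq = miss (x , sym eq)

-- The permutation listing the values in ≺-increasing order.
sorted : {_≺_ : Rel (Fin n) 0ℓ} → IsStrictTotalOrder _≡_ _≺_ → Permutation′ n
sorted sto = permutation (proj₁ ∘ onto) (rank sto)
  (λ u → rank-injective sto (proj₂ (onto (rank sto u))))
  (proj₂ ∘ onto)
  where onto = injective⇒surjective (rank sto) (rank-injective sto)

sorted⁺ : {_≺_ : Rel (Fin n) 0ℓ} (sto : IsStrictTotalOrder _≡_ _≺_) →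
          ∀ {u v} → u ≺ v → Precedes (sorted sto) u v
sorted⁺ sto = rank-mono sto

sorted⁻ : {_≺_ : Rel (Fin n) 0ℓ} (sto : IsStrictTotalOrder _≡_ _≺_) →
          ∀ {u v} → Precedes (sorted sto) u v → u ≺ v
sorted⁻ sto {u} {v} lt with IsStrictTotalOrder.compare sto u v
... | tri< u≺v _ _  = u≺v
... | tri≈ _ refl _ = contradiction lt (<-irrefl refl)
... | tri> _ _ v≺u  = contradiction lt (<-asym (rank-mono sto v≺u))

-- The transitive closure R⁺ of a relation R ⊆ (<) satisfying
-- R a c → R a b ⊎ R b c for a < b < c is the inversion set of a total order ≺.
module Closure (R : Rel (Fin n) 0ℓ) (R⇒< : R ⇒ _<_) (R? : Decidable R)
  (R-split : ∀ {a b c} → a < b → b < c → R a c → R a b ⊎ R b c) where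

  R⁺ : Rel (Fin n) 0ℓ
  R⁺ = TransClosure R

  infix 4 _≺_

  _≺_ : Rel (Fin n) 0ℓ
  u ≺ v = (u < v × ¬ R⁺ u v) ⊎ R⁺ v u

  R⁺⇒< : R⁺ ⇒ _<_
  R⁺⇒< [ r ]   = R⇒< r
  R⁺⇒< (r ∷ t) = <-trans (R⇒< r) (R⁺⇒< t)

  private
    _·_ : Transitive R⁺
    _·_ = Plus._++_

    R⁺?-acc : ∀ a c → Acc _>_ a → Dec (R⁺ a c)
    R⁺?-acc a c (acc rec) with R? a c
    ... | yes r = yes [ r ]
    ... | no ¬r with any? step?
      where
      step? : ∀ b → Dec (R a b × R⁺ b c)
      step? b with R? a b
      ... | no ¬r = no (¬r ∘ proj₁)
      ... | yes r with R⁺?-acc b c (rec (R⇒< r))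
      ...   | yes t = yes (r , t)
      ...   | no ¬t = no (¬t ∘ proj₂)
    ...   | yes (_ , r , t) = yes (r ∷ t)
    ...   | no ¬step = no λ where
      [ r ]   → ¬r r
      (r ∷ t) → ¬step (_ , r , t)

  R⁺? : Decidable R⁺
  R⁺? a c = R⁺?-acc a c (>-wellFounded a)

  R⁺-split : ∀ {a b c} → a < b → b < c → R⁺ a c → R⁺ a b ⊎ R⁺ b c
  R⁺-split a<b b<c [ r ] = Sum.map [_] [_] (R-split a<b b<c r)
  R⁺-split {b = b} a<b b<c (_∷_ {y = x} r t) with <-cmp b x
  ... | tri< b<x _ _  = Sum.map [_] (_∷ t) (R-split a<b b<x r)
  ... | tri≈ _ refl _ = inj₁ [ r ]
  ... | tri> _ _ x<b  = Sum.map₁ (r ∷_) (R⁺-split x<b b<c t)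

  private
    ≺-trans : Transitive _≺_
    ≺-trans (inj₁ (u<v , ¬uv)) (inj₁ (v<w , ¬vw)) =
      inj₁ (<-trans u<v v<w , [ ¬uv , ¬vw ]′ ∘ R⁺-split u<v v<w)
    ≺-trans {u} {v} {w} (inj₁ (u<v , ¬uv)) (inj₂ wv) with <-cmp u w
    ... | tri< u<w _ _  = inj₁ (u<w , λ uw → ¬uv (uw · wv))
    ... | tri≈ _ refl _ = contradiction wv ¬uv
    ... | tri> _ _ w<u  = [ inj₂ , flip contradiction ¬uv ]′ (R⁺-split w<u u<v wv)
    ≺-trans {u} {v} {w} (inj₂ vu) (inj₁ (v<w , ¬vw)) with <-cmp u w
    ... | tri< u<w _ _  = inj₁ (u<w , λ uw → ¬vw (vu · uw))
    ... | tri≈ _ refl _ = contradiction vu ¬vw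
    ... | tri> _ _ w<u  = [ flip contradiction ¬vw , inj₂ ]′ (R⁺-split v<w w<u vu)
    ≺-trans (inj₂ vu) (inj₂ wv) = inj₂ (wv · vu)

    ≺-irrefl : ∀ {u} → ¬ u ≺ u
    ≺-irrefl (inj₁ (u<u , _)) = <-irrefl refl u<u
    ≺-irrefl (inj₂ uu)        = <-irrefl refl (R⁺⇒< uu)

    ≺-total : ∀ {u v} → u < v → u ≺ v ⊎ v ≺ u
    ≺-total {u} {v} u<v with R⁺? u v
    ... | yes uv = inj₂ (inj₂ uv)
    ... | no ¬uv = inj₁ (inj₁ (u<v , ¬uv))

    ≺-before : ∀ {u v} → u ≺ v → ¬ v ≺ u
    ≺-before u≺v v≺u = ≺-irrefl (≺-trans u≺v v≺u)

    from-⊎ : ∀ {u v} → ¬ u ≡ v → u ≺ v ⊎ v ≺ u → Tri (u ≺ v) (u ≡ v) (v ≺ u)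
    from-⊎ u≢v (inj₁ u≺v) = tri< u≺v u≢v (≺-before u≺v)
    from-⊎ u≢v (inj₂ v≺u) = tri> (≺-before v≺u) u≢v v≺u

    ≺-cmp : Trichotomous _≡_ _≺_
    ≺-cmp u v with <-cmp u v
    ... | tri< u<v u≢v _ = from-⊎ u≢v (≺-total u<v)
    ... | tri≈ _ refl _  = tri≈ ≺-irrefl refl ≺-irrefl
    ... | tri> _ u≢v v<u = from-⊎ u≢v (Sum.swap (≺-total v<u))

  ≺-isStrictTotalOrder : IsStrictTotalOrder _≡_ _≺_
  ≺-isStrictTotalOrder = record
    { isStrictPartialOrder = record
      { isEquivalence = isEquivalence
      ; irrefl        = λ { refl → ≺-irrefl }
      ; trans         = ≺-trans
      ; <-resp-≈      = resp₂ _≺_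
      }
    ; compare = ≺-cmp
    }

  ≻-isStrictTotalOrder : IsStrictTotalOrder _≡_ (flip _≺_)
  ≻-isStrictTotalOrder = Flip.isStrictTotalOrder ≺-isStrictTotalOrder

  ≺⇒R⁺ : ∀ {a b} → a < b → b ≺ a → R⁺ a b
  ≺⇒R⁺ a<b (inj₁ (b<a , _)) = contradiction b<a (<-asym a<b)
  ≺⇒R⁺ a<b (inj₂ ab)        = ab

Ninv : Permutation′ n → Rel (Fin n) 0ℓ
Ninv σ a b = a < b × Precedes σ a b

σ⁻¹-injective : ∀ (σ : Permutation′ n) {u v} → σ ⟨$⟩ˡ u ≡ σ ⟨$⟩ˡ v → u ≡ v
σ⁻¹-injective σ eq = trans (sym (inverseʳ σ)) (trans (cong (σ ⟨$⟩ʳ_) eq) (inverseʳ σ))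

precedes-total : ∀ (σ : Permutation′ n) {u v} → ¬ u ≡ v → Precedes σ u v ⊎ Precedes σ v u
precedes-total σ {u} {v} u≢v with <-cmp (σ ⟨$⟩ˡ u) (σ ⟨$⟩ˡ v)
... | tri< lt _ _ = inj₁ lt
... | tri≈ _ eq _ = contradiction (σ⁻¹-injective σ eq) u≢v
... | tri> _ _ gt = inj₂ gt

Inv-split : ∀ (σ : Permutation′ n) {a b c} → a < b → b < c → Inv σ a c → Inv σ a b ⊎ Inv σ b c
Inv-split σ a<b b<c (_ , c∙a) with precedes-total σ (<⇒≢ a<b)
... | inj₁ a∙b = inj₂ (b<c , <-trans c∙a a∙b)
... | inj₂ b∙a = inj₁ (a<b , b∙a)

Ninv-split : ∀ (σ : Permutation′ n) {a b c} → a < b → b < c → Ninv σ a c → Ninv σ a b ⊎ Ninv σ b c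
Ninv-split σ a<b b<c (_ , a∙c) with precedes-total σ (<⇒≢ a<b)
... | inj₁ a∙b = inj₁ (a<b , a∙b)
... | inj₂ b∙a = inj₂ (b<c , <-trans b∙a a∙c)

Inv-trans : ∀ (σ : Permutation′ n) → Transitive (Inv σ)
Inv-trans σ (a<b , b∙a) (b<c , c∙b) = <-trans a<b b<c , <-trans c∙b b∙a

Ninv-trans : ∀ (σ : Permutation′ n) → Transitive (Ninv σ)
Ninv-trans σ (a<b , a∙b) (b<c , b∙c) = <-trans a<b b<c , <-trans a∙b b∙c

Inv? : ∀ (σ : Permutation′ n) → Decidable (Inv σ)
Inv? σ a b = (a <? b) ×-dec (σ ⟨$⟩ˡ b <? σ ⟨$⟩ˡ a)

Ninv? : ∀ (σ : Permutation′ n) → Decidable (Ninv σ)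
Ninv? σ a b = (a <? b) ×-dec (σ ⟨$⟩ˡ a <? σ ⟨$⟩ˡ b)

≼ₛ⇒Ninv : ∀ (σ τ : Permutation′ n) → σ ≼ₛ τ → Ninv τ ⇒ Ninv σ
≼ₛ⇒Ninv σ τ σ≼τ (a<b , a∙b) with precedes-total σ (<⇒≢ a<b)
... | inj₁ lt = a<b , lt
... | inj₂ gt = contradiction (proj₂ (σ≼τ (a<b , gt))) (<-asym a∙b)

Ninv⇒≼ₛ : ∀ (σ τ : Permutation′ n) → (Ninv τ ⇒ Ninv σ) → σ ≼ₛ τ
Ninv⇒≼ₛ σ τ τ⊆σ (a<b , b∙a) with precedes-total τ (<⇒≢ a<b)
... | inj₁ lt = contradiction (proj₂ (τ⊆σ (a<b , lt))) (<-asym b∙a)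
... | inj₂ gt = a<b , gt

closure-least : {R S : Rel (Fin n) 0ℓ} → Transitive S → R ⇒ S → TransClosure R ⇒ S
closure-least S-trans R⊆S [ r ]   = R⊆S r
closure-least S-trans R⊆S (r ∷ t) = S-trans (R⊆S r) (closure-least S-trans R⊆S t)

module ClosureInv {n} (σ τ : Permutation′ n) = Closure
  (λ a b → Inv σ a b ⊎ Inv τ a b) [ proj₁ , proj₁ ]′
  (λ a b → Inv? σ a b ⊎-dec Inv? τ a b)
  (λ a<b b<c → [ Sum.map inj₁ inj₁ ∘ Inv-split σ a<b b<c , Sum.map inj₂ inj₂ ∘ Inv-split τ a<b b<c ]′)

module ClosureNinv {n} (σ τ : Permutation′ n) = Closure
  (λ a b → Ninv σ a b ⊎ Ninv τ a b) [ proj₁ , proj₁ ]′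
  (λ a b → Ninv? σ a b ⊎-dec Ninv? τ a b)
  (λ a<b b<c → [ Sum.map inj₁ inj₁ ∘ Ninv-split σ a<b b<c , Sum.map inj₂ inj₂ ∘ Ninv-split τ a<b b<c ]′)

infixr 6 _∨ₛ_
infixr 7 _∧ₛ_

-- Inv (σ ∨ₛ τ) is the transitive closure of Inv σ ∪ Inv τ.
_∨ₛ_ : Op₂ (Permutation′ n)
σ ∨ₛ τ = sorted (ClosureInv.≺-isStrictTotalOrder σ τ)

-- Ninv (σ ∧ₛ τ) is the transitive closure of Ninv σ ∪ Ninv τ.
_∧ₛ_ : Op₂ (Permutation′ n)
σ ∧ₛ τ = sorted (ClosureNinv.≻-isStrictTotalOrder σ τ)

∨ₛ-supremum : Supremum (_≼ₛ_ {n}) _∨ₛ_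
∨ₛ-supremum σ τ = (λ r → upper (inj₁ r)) , (λ r → upper (inj₂ r)) , least
  where
  open ClosureInv σ τ
  upper : ∀ {a b} → Inv σ a b ⊎ Inv τ a b → Inv (σ ∨ₛ τ) a b
  upper r = R⁺⇒< [ r ] , sorted⁺ ≺-isStrictTotalOrder (inj₂ [ r ])
  least : ∀ ρ → σ ≼ₛ ρ → τ ≼ₛ ρ → σ ∨ₛ τ ≼ₛ ρ
  least ρ σ≼ρ τ≼ρ (a<b , b∙a) = closure-least (Inv-trans ρ) [ σ≼ρ , τ≼ρ ]′
    (≺⇒R⁺ a<b (sorted⁻ ≺-isStrictTotalOrder b∙a))

∧ₛ-infimum : Infimum (_≼ₛ_ {n}) _∧ₛ_
∧ₛ-infimum σ τ =
    Ninv⇒≼ₛ (σ ∧ₛ τ) σ (λ r → lower (inj₁ r))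
  , Ninv⇒≼ₛ (σ ∧ₛ τ) τ (λ r → lower (inj₂ r))
  , greatest
  where
  open ClosureNinv σ τ
  lower : ∀ {a b} → Ninv σ a b ⊎ Ninv τ a b → Ninv (σ ∧ₛ τ) a b
  lower r = R⁺⇒< [ r ] , sorted⁺ ≻-isStrictTotalOrder (inj₂ [ r ])
  greatest : ∀ ρ → ρ ≼ₛ σ → ρ ≼ₛ τ → ρ ≼ₛ σ ∧ₛ τ
  greatest ρ ρ≼σ ρ≼τ = Ninv⇒≼ₛ ρ (σ ∧ₛ τ) λ { (a<b , a∙b) →
    closure-least (Ninv-trans ρ) [ ≼ₛ⇒Ninv ρ σ ρ≼σ , ≼ₛ⇒Ninv ρ τ ρ≼τ ]′
      (≺⇒R⁺ a<b (sorted⁻ ≻-isStrictTotalOrder a∙b)) }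

◁[_,_] : Permutation′ n → Permutation′ n → 𝒫 n
◁[ σ , σ′ ] = record
  { _◁_ = λ u v → σ ⊢ u ⊴ v × σ′ ⊢ u ⊴ v
  ; isDecPartialOrder = record
    { isPartialOrder = record
      { isPreorder = record
        { isEquivalence = isEquivalence
        ; reflexive     = λ { refl → ≤-refl , ≤-refl }
        ; trans         = λ (p , p′) (q , q′) → ≤-trans p q , ≤-trans p′ q′
        }
      ; antisym = λ (p , _) (q , _) → σ⁻¹-injective σ (≤-antisym p q)
      }
    ; _≟_  = _≟_
    ; _≤?_ = λ u v → (σ ⟨$⟩ˡ u ≤? σ ⟨$⟩ˡ v) ×-dec (σ′ ⟨$⟩ˡ u ≤? σ′ ⟨$⟩ˡ v)
    }
  }

IsWOIP : Pred (𝒫 n) 0ℓ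
IsWOIP {n} p = ∃[ σ ] ∃[ σ′ ] (σ ≼ₛ σ′ × p ≈ ◁[ σ , σ′ ])

WOIP : ℕ → Set₁
WOIP n = ∃ (IsWOIP {n})

≈-refl : (p : 𝒫 n) → p ≈ p
≈-refl p a b = mk⇔ (λ x → x) (λ x → x)

≼-antisym : (p q : 𝒫 n) → p ≼ q → q ≼ p → p ≈ q
≼-antisym p q (q⊆p , p⊆q) (p⊆q′ , q⊆p′) a b with ≤-total a b
... | inj₁ a≤b = mk⇔ (λ r → proj₂ (p⊆q′ (a≤b , r))) (λ r → proj₂ (q⊆p (a≤b , r)))
... | inj₂ b≤a = mk⇔ (λ r → proj₂ (p⊆q (b≤a , r))) (λ r → proj₂ (q⊆p′ (b≤a , r)))

≈⇒≼ : (p q : 𝒫 n) → p ≈ q → p ≼ q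
≈⇒≼ p q p≈q = (λ (l , r) → l , Equivalence.from (p≈q _ _) r)
            , (λ (l , r) → l , Equivalence.to (p≈q _ _) r)

strict : ∀ (σ : Permutation′ n) {u v} → ¬ u ≡ v → σ ⊢ u ⊴ v → Precedes σ u v
strict σ u≢v le = ≤∧≢⇒< le (u≢v ∘ σ⁻¹-injective σ)

≡⇒⊴ : ∀ (σ : Permutation′ n) {u v} → u ≡ v → σ ⊢ u ⊴ v
≡⇒⊴ σ eq = ≤-reflexive (cong (σ ⟨$⟩ˡ_) eq)

-- A weak order comparison of intervals is a comparison of both endpoints.
module _ {σ σ′ τ τ′ : Permutation′ n} (σ≼σ′ : σ ≼ₛ σ′) (τ≼τ′ : τ ≼ₛ τ′)
         {p q : 𝒫 n} (p≈ : p ≈ ◁[ σ , σ′ ]) (q≈ : q ≈ ◁[ τ , τ′ ]) where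

  endpoints⁺ : σ ≼ₛ τ → σ′ ≼ₛ τ′ → p ≼ q
  endpoints⁺ σ≼τ σ′≼τ′ = inc , dcr
    where
    inc : Inc q ⇒ Inc p
    inc {a} {b} (a≤b , r) with a ≟ b
    ... | yes a≡b = a≤b , Equivalence.from (p≈ a b) (≡⇒⊴ σ a≡b , ≡⇒⊴ σ′ a≡b)
    ... | no a≢b = a≤b , Equivalence.from (p≈ a b) (ℕ.<⇒≤ (proj₂ n₂) , ℕ.<⇒≤ (proj₂ n₁))
      where
      n₁ = ≼ₛ⇒Ninv σ′ τ′ σ′≼τ′ (≤∧≢⇒< a≤b a≢b , strict τ′ a≢b (proj₂ (Equivalence.to (q≈ a b) r)))
      n₂ = ≼ₛ⇒Ninv σ σ′ σ≼σ′ n₁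
    dcr : Dcr p ⇒ Dcr q
    dcr {b} {a} (a≤b , r) with b ≟ a
    ... | yes b≡a = a≤b , Equivalence.from (q≈ b a) (≡⇒⊴ τ b≡a , ≡⇒⊴ τ′ b≡a)
    ... | no b≢a = a≤b , Equivalence.from (q≈ b a) (ℕ.<⇒≤ (proj₂ i₁) , ℕ.<⇒≤ (proj₂ i₂))
      where
      i₁ = σ≼τ (≤∧≢⇒< a≤b (b≢a ∘ sym) , strict σ b≢a (proj₁ (Equivalence.to (p≈ b a) r)))
      i₂ = τ≼τ′ i₁

  endpoints⁻ : p ≼ q → σ ≼ₛ τ × σ′ ≼ₛ τ′
  endpoints⁻ (inc , dcr) = lo , Ninv⇒≼ₛ σ′ τ′ hi
    where
    lo : σ ≼ₛ τ
    lo {a} {b} i@(a<b , b∙a) = a<b , strict τ (<⇒≢ a<b ∘ sym) (proj₁ (Equivalence.to (q≈ b a)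
      (proj₂ (dcr (ℕ.<⇒≤ a<b , Equivalence.from (p≈ b a) (ℕ.<⇒≤ b∙a , ℕ.<⇒≤ (proj₂ (σ≼σ′ i))))))))
    hi : Ninv τ′ ⇒ Ninv σ′
    hi {a} {b} i@(a<b , a∙b) = a<b , strict σ′ (<⇒≢ a<b) (proj₂ (Equivalence.to (p≈ a b)
      (proj₂ (inc (ℕ.<⇒≤ a<b , Equivalence.from (q≈ a b) (ℕ.<⇒≤ (proj₂ (≼ₛ⇒Ninv τ τ′ τ≼τ′ i)) , ℕ.<⇒≤ a∙b))))))

infixr 6 _∨_
infixr 7 _∧_

-- The endpoints are determined by the poset: by ≼⇒endpoints below, equal posets
-- have endpoints with the same inversions.

_∨_ : Op₂ (WOIP n)
(_ , σ , σ′ , σ≼σ′ , _) ∨ (_ , τ , τ′ , τ≼τ′ , _) =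
  ◁[ σ ∨ₛ τ , σ′ ∨ₛ τ′ ] , σ ∨ₛ τ , σ′ ∨ₛ τ′ ,
  (let (σ′≼ , τ′≼ , _) = ∨ₛ-supremum σ′ τ′ in
   proj₂ (proj₂ (∨ₛ-supremum σ τ)) (σ′ ∨ₛ τ′) (λ i → σ′≼ (σ≼σ′ i)) (λ i → τ′≼ (τ≼τ′ i))) ,
  ≈-refl ◁[ σ ∨ₛ τ , σ′ ∨ₛ τ′ ]

_∧_ : Op₂ (WOIP n)
(_ , σ , σ′ , σ≼σ′ , _) ∧ (_ , τ , τ′ , τ≼τ′ , _) =
  ◁[ σ ∧ₛ τ , σ′ ∧ₛ τ′ ] , σ ∧ₛ τ , σ′ ∧ₛ τ′ ,
  (let (≼σ , ≼τ , _) = ∧ₛ-infimum σ τ in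
   proj₂ (proj₂ (∧ₛ-infimum σ′ τ′)) (σ ∧ₛ τ) (λ i → σ≼σ′ (≼σ i)) (λ i → τ≼τ′ (≼τ i))) ,
  ≈-refl ◁[ σ ∧ₛ τ , σ′ ∧ₛ τ′ ]

_≼ʷ_ : Rel (WOIP n) 0ℓ
(p , _) ≼ʷ (q , _) = p ≼ q

endpoints⇒≼ : (P Q : WOIP n) → let (_ , σ , σ′ , _) = P; (_ , τ , τ′ , _) = Q in
     σ ≼ₛ τ → σ′ ≼ₛ τ′ → P ≼ʷ Q
endpoints⇒≼ (p , σ , σ′ , i , p≈) (q , τ , τ′ , j , q≈) =
  endpoints⁺ {σ = σ} {σ′} {τ} {τ′} i j {p} {q} p≈ q≈

≼⇒endpoints : (P Q : WOIP n) → let (_ , σ , σ′ , _) = P; (_ , τ , τ′ , _) = Q in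
       P ≼ʷ Q → σ ≼ₛ τ × σ′ ≼ₛ τ′
≼⇒endpoints (p , σ , σ′ , i , p≈) (q , τ , τ′ , j , q≈) =
  endpoints⁻ {σ = σ} {σ′} {τ} {τ′} i j {p} {q} p≈ q≈

∨-supremum : Supremum (_≼ʷ_ {n}) _∨_
∨-supremum P@(_ , σ , σ′ , _) Q@(_ , τ , τ′ , _) =
  let (l₁ , l₂ , l₃) = ∨ₛ-supremum σ τ
      (h₁ , h₂ , h₃) = ∨ₛ-supremum σ′ τ′
  in endpoints⇒≼ P (P ∨ Q) l₁ h₁ , endpoints⇒≼ Q (P ∨ Q) l₂ h₂ ,
     λ Z@(_ , ρ , ρ′ , _) P≼Z Q≼Z → endpoints⇒≼ (P ∨ Q) Z
       (l₃ ρ (proj₁ (≼⇒endpoints P Z P≼Z)) (proj₁ (≼⇒endpoints Q Z Q≼Z)))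
       (h₃ ρ′ (proj₂ (≼⇒endpoints P Z P≼Z)) (proj₂ (≼⇒endpoints Q Z Q≼Z)))

∧-infimum : Infimum (_≼ʷ_ {n}) _∧_
∧-infimum P@(_ , σ , σ′ , _) Q@(_ , τ , τ′ , _) =
  let (l₁ , l₂ , l₃) = ∧ₛ-infimum σ τ
      (h₁ , h₂ , h₃) = ∧ₛ-infimum σ′ τ′
  in endpoints⇒≼ (P ∧ Q) P l₁ h₁ , endpoints⇒≼ (P ∧ Q) Q l₂ h₂ ,
     λ Z@(_ , ρ , ρ′ , _) Z≼P Z≼Q → endpoints⇒≼ Z (P ∧ Q)
       (l₃ ρ (proj₁ (≼⇒endpoints Z P Z≼P)) (proj₁ (≼⇒endpoints Z Q Z≼Q)))
       (h₃ ρ′ (proj₂ (≼⇒endpoints Z P Z≼P)) (proj₂ (≼⇒endpoints Z Q Z≼Q)))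

WOIP-lattice : ℕ → Lattice (lsuc 0ℓ) 0ℓ 0ℓ
WOIP-lattice n = record
  { Carrier   = WOIP n
  ; _≈_       = λ (p , _) (q , _) → p ≈ q
  ; _≤_       = λ (p , _) (q , _) → p ≼ q
  ; _∨_       = _∨_
  ; _∧_       = _∧_
  ; isLattice = record
    { isPartialOrder = record
      { isPreorder = record
        { isEquivalence = record
          { refl  = λ {(p , _)} → ≈-refl p
          ; sym   = λ e a b → mk⇔ (Equivalence.from (e a b)) (Equivalence.to (e a b))
          ; trans = λ e f a b → mk⇔ (Equivalence.to (f a b) ∘ Equivalence.to (e a b))
                                    (Equivalence.from (e a b) ∘ Equivalence.from (f a b))
          }
        ; reflexive = λ {(p , _)} {(q , _)} → ≈⇒≼ p q
        ; trans     = λ (i , d) (i′ , d′) → (λ x → i (i′ x)) , (λ x → d′ (d x))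
        }
      ; antisym = λ {(p , _)} {(q , _)} → ≼-antisym p q
      }
    ; supremum = ∨-supremum
    ; infimum  = ∧-infimum
    }
  }

InducesSublattice : ∀ {c ℓ₁ ℓ₂ ℓ} (L : Lattice c ℓ₁ ℓ₂) → Pred (Lattice.Carrier L) ℓ → Set (c ⊔ ℓ)
InducesSublattice L S = ∀ x y → S x → S y → S (x L.∧ y) × S (x L.∨ y)
  where module L = Lattice L

record Orientation (n : ℕ) : Set where
  field
    𝕆⁺ 𝕆⁻ : Subset n

open Orientation public

data Sign : Set where
  ∅ˢ −ˢ +ˢ ±ˢ : Sign

IPIP⁺ IPIP⁻ DPIP⁺ DPIP⁻ IPIP∅ DPIP∅ : Orientation n → Pred (𝒫 n) 0ℓ

IPIP⁺ 𝕆 p = ∀ a b c → a < b → b < c → b ∈ 𝕆⁺ 𝕆 → p ⊢ a ◁ c → p ⊢ a ◁ b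
IPIP⁻ 𝕆 p = ∀ a b c → a < b → b < c → b ∈ 𝕆⁻ 𝕆 → p ⊢ a ◁ c → p ⊢ b ◁ c
DPIP⁺ 𝕆 p = ∀ a b c → a < b → b < c → b ∈ 𝕆⁺ 𝕆 → p ⊢ a ▷ c → p ⊢ b ▷ c
DPIP⁻ 𝕆 p = ∀ a b c → a < b → b < c → b ∈ 𝕆⁻ 𝕆 → p ⊢ a ▷ c → p ⊢ a ▷ b

IPIP∅ 𝕆 p = ∃[ σ ] IsMaximalLinearExtension p σ
  × (∀ a b c → a < b → b < c → b ∈ 𝕆⁺ 𝕆 → ¬ (Precedes σ b a × Precedes σ a c))
  × (∀ a b c → a < b → b < c → b ∈ 𝕆⁻ 𝕆 → ¬ (Precedes σ a c × Precedes σ c b))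

DPIP∅ 𝕆 p = ∃[ σ ] IsMinimalLinearExtension p σ
  × (∀ a b c → a < b → b < c → b ∈ 𝕆⁺ 𝕆 → ¬ (Precedes σ b c × Precedes σ c a))
  × (∀ a b c → a < b → b < c → b ∈ 𝕆⁻ 𝕆 → ¬ (Precedes σ c a × Precedes σ a b))

IPIP DPIP : Sign → Orientation n → Pred (𝒫 n) 0ℓ

IPIP ∅ˢ 𝕆 = IPIP∅ 𝕆
IPIP −ˢ 𝕆 = IPIP⁻ 𝕆
IPIP +ˢ 𝕆 = IPIP⁺ 𝕆
IPIP ±ˢ 𝕆 = IPIP⁺ 𝕆 ∩ IPIP⁻ 𝕆

DPIP ∅ˢ 𝕆 = DPIP∅ 𝕆
DPIP −ˢ 𝕆 = DPIP⁻ 𝕆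
DPIP +ˢ 𝕆 = DPIP⁺ 𝕆
DPIP ±ˢ 𝕆 = DPIP⁺ 𝕆 ∩ DPIP⁻ 𝕆

{-# OPTIONS --safe #-}
-- For an interval poset p = ◁[ σ , σ′ ] the increasing relations of p are the
-- non-inversions of σ′ and its decreasing relations are the inversions of σ,
-- so each IPIP (DPIP) condition says that Ninv σ′ (Inv σ) is stable under
-- shortening a pair (a , c) at one end to a point b between a and c.  Such a
-- condition passes to the transitive closure of a union: shorten the step of the
-- chain that jumps over b.  Its contrapositive, a stability of the complementary
-- relation under lengthening, also passes to closures: lengthen the extremal step.
-- As one of the two relations of a meet or join is a closure, both operations
-- preserve every condition.  Finally σ′ (σ) is the maximal (minimal) linear
-- extension of p, which makes IPIP∅ (DPIP∅) agree with IPIP± (DPIP±).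
module Submission where

open import Defs
open import Data.Fin.Base using (Fin; _<_)
open import Data.Fin.Properties using (<-asym; <-cmp; <-trans; <⇒≢)
open import Data.Fin.Permutation using (Permutation′)
open import Data.Fin.Subset using (Subset; _∈_)
open import Data.Nat.Base using (ℕ)
import Data.Nat.Properties as ℕ
open import Data.Product.Base using (_×_; _,_; proj₁; proj₂)
open import Data.Sum.Base using (_⊎_; inj₁; inj₂; [_,_]′; swap)
open import Function.Base using (_∘_)
open import Function.Bundles using (_⇔_; mk⇔; module Equivalence)
open import Level using (0ℓ)
open import Relation.Binary.Construct.Closure.Transitive using (TransClosure; [_]; _∷_)
open import Relation.Binary.Core using (Rel; _⇒_)
open import Relation.Binary.Construct.Union using (_∪_)
open import Relation.Binary.Definitions using (tri<; tri≈; tri>)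
open import Relation.Binary.Lattice.Bundles using (Lattice)
open import Relation.Binary.PropositionalEquality using (refl; sym)
open import Relation.Nullary using (¬_; contradiction)
open import Relation.Unary using (Pred; _∩_)

open Equivalence using (to; from)

private
  variable
    n : ℕ
    X : Subset n
    R S T : Rel (Fin n) 0ℓ

-- Stability under shortening and lengthening of pairs.

-- The end of the pair that is kept fixed.
data End : Set where
  left right : End

-- In all four, `b` is the end tested against `X`: the one reached by shortening or the one left by
-- lengthening. This makes `Grows` for a relation the contrapositive of `Shrinks` for its
-- complement.
Shrinks Grows : End → Subset n → Pred (Rel (Fin n) 0ℓ) 0ℓ
Shrinks left  X S = ∀ a b c → a < b → b < c → b ∈ X → S a c → S a b
Shrinks right X S = ∀ a b c → a < b → b < c → b ∈ X → S a c → S b c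
Grows   left  X S = ∀ a b c → a < b → b < c → b ∈ X → S a b → S a c
Grows   right X S = ∀ a b c → a < b → b < c → b ∈ X → S b c → S a c

-- Induction along the chain, comparing `b` with the end `x` of the first step. With the left end
-- fixed, the steps after the one over `b` are discarded; with the right end fixed, those before it.
Shrinks-⁺ : ∀ e → Shrinks e X R → Shrinks e X (TransClosure R)
Shrinks-⁺ left  sh a b c a<b b<c b∈X [ r ] = [ sh a b c a<b b<c b∈X r ]
Shrinks-⁺ left  sh a b c a<b b<c b∈X (_∷_ {y = x} r t) with <-cmp b x
... | tri< b<x _ _  = [ sh a b x a<b b<x b∈X r ]
... | tri≈ _ refl _ = [ r ]
... | tri> _ _ x<b  = r ∷ Shrinks-⁺ left sh x b c x<b b<c b∈X t
Shrinks-⁺ right sh a b c a<b b<c b∈X [ r ] = [ sh a b c a<b b<c b∈X r ]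
Shrinks-⁺ right sh a b c a<b b<c b∈X (_∷_ {y = x} r t) with <-cmp b x
... | tri< b<x _ _  = sh a b x a<b b<x b∈X r ∷ t
... | tri≈ _ refl _ = t
... | tri> _ _ x<b  = Shrinks-⁺ right sh x b c x<b b<c b∈X t

-- With the left end fixed the last step is lengthened, with the right end fixed the first. Chains
-- increase because of `R ⇒ _<_`, which puts `b` strictly inside the lengthened step.
Grows-⁺ : ∀ e → R ⇒ _<_ → Grows e X R → Grows e X (TransClosure R)
Grows-⁺ left  R⇒< gr a b c a<b b<c b∈X [ r ] = [ gr a b c a<b b<c b∈X r ]
Grows-⁺ left  R⇒< gr a b c a<b b<c b∈X (_∷_ {y = x} r t) =
  r ∷ Grows-⁺ left R⇒< gr x b c (closure-least <-trans R⇒< t) b<c b∈X t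
Grows-⁺ right R⇒< gr a b c a<b b<c b∈X [ r ] = [ gr a b c a<b b<c b∈X r ]
Grows-⁺ right R⇒< gr a b c a<b b<c b∈X (_∷_ {y = x} r t) =
  gr a b x a<b (R⇒< r) b∈X r ∷ t

Shrinks-∪ : ∀ e → Shrinks e X S → Shrinks e X T → Shrinks e X (S ∪ T)
Shrinks-∪ left  f g a b c a<b b<c b∈X =
  [ inj₁ ∘ f a b c a<b b<c b∈X , inj₂ ∘ g a b c a<b b<c b∈X ]′
Shrinks-∪ right f g a b c a<b b<c b∈X =
  [ inj₁ ∘ f a b c a<b b<c b∈X , inj₂ ∘ g a b c a<b b<c b∈X ]′

Grows-∪ : ∀ e → Grows e X S → Grows e X T → Grows e X (S ∪ T)
Grows-∪ left  f g a b c a<b b<c b∈X =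
  [ inj₁ ∘ f a b c a<b b<c b∈X , inj₂ ∘ g a b c a<b b<c b∈X ]′
Grows-∪ right f g a b c a<b b<c b∈X =
  [ inj₁ ∘ f a b c a<b b<c b∈X , inj₂ ∘ g a b c a<b b<c b∈X ]′

Shrinks-resp : ∀ e → S ⇒ T → T ⇒ S → Shrinks e X S → Shrinks e X T
Shrinks-resp left  S⇒T T⇒S f a b c a<b b<c b∈X = S⇒T ∘ f a b c a<b b<c b∈X ∘ T⇒S
Shrinks-resp right S⇒T T⇒S f a b c a<b b<c b∈X = S⇒T ∘ f a b c a<b b<c b∈X ∘ T⇒S

Grows-resp : ∀ e → S ⇒ T → T ⇒ S → Grows e X S → Grows e X T
Grows-resp left  S⇒T T⇒S f a b c a<b b<c b∈X = S⇒T ∘ f a b c a<b b<c b∈X ∘ T⇒S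
Grows-resp right S⇒T T⇒S f a b c a<b b<c b∈X = S⇒T ∘ f a b c a<b b<c b∈X ∘ T⇒S

-- Passage to the complementary relation.

Complementary : Rel (Fin n) 0ℓ → Rel (Fin n) 0ℓ → Set
Complementary S T =
  (∀ a b → a < b → S a b ⊎ T a b) × (∀ a b → S a b → ¬ T a b)

Complementary-sym : Complementary S T → Complementary T S
Complementary-sym (total , disjoint) =
  (λ a b → swap ∘ total a b) , (λ a b t s → disjoint a b s t)

-- If `S` held at the lengthened pair, shortening would give `S` at the original pair, against `T`.
Shrinks⇒Grows : ∀ e → Complementary S T → Shrinks e X S → Grows e X T
Shrinks⇒Grows left (total , disjoint) sh a b c a<b b<c b∈X t
  with total a c (<-trans a<b b<c)
... | inj₁ s  = contradiction t (disjoint a b (sh a b c a<b b<c b∈X s))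
... | inj₂ t′ = t′
Shrinks⇒Grows right (total , disjoint) sh a b c a<b b<c b∈X t
  with total a c (<-trans a<b b<c)
... | inj₁ s  = contradiction t (disjoint b c (sh a b c a<b b<c b∈X s))
... | inj₂ t′ = t′

Grows⇒Shrinks : ∀ e → Complementary S T → Grows e X S → Shrinks e X T
Grows⇒Shrinks left (total , disjoint) gr a b c a<b b<c b∈X t with total a b a<b
... | inj₁ s  = contradiction t (disjoint a c (gr a b c a<b b<c b∈X s))
... | inj₂ t′ = t′
Grows⇒Shrinks right (total , disjoint) gr a b c a<b b<c b∈X t with total b c b<c
... | inj₁ s  = contradiction t (disjoint a c (gr a b c a<b b<c b∈X s))
... | inj₂ t′ = t′

-- Inversions and non-inversions of joins and meets.

Inv-Ninv-complementary : (σ : Permutation′ n) → Complementary (Inv σ) (Ninv σ)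
Inv-Ninv-complementary σ = total , λ a b (_ , b∙a) (_ , a∙b) → <-asym a∙b b∙a
  where
  total : ∀ a b → a < b → Inv σ a b ⊎ Ninv σ a b
  total a b a<b with precedes-total σ (<⇒≢ a<b)
  ... | inj₁ a∙b = inj₂ (a<b , a∙b)
  ... | inj₂ b∙a = inj₁ (a<b , b∙a)

Ninv-Inv-complementary : (σ : Permutation′ n) → Complementary (Ninv σ) (Inv σ)
Ninv-Inv-complementary σ = Complementary-sym (Inv-Ninv-complementary σ)

module _ (σ τ : Permutation′ n) where

  Inv-∨⇒⁺ : Inv (σ ∨ₛ τ) ⇒ TransClosure (Inv σ ∪ Inv τ)
  Inv-∨⇒⁺ (a<b , b∙a) = ≺⇒R⁺ a<b (sorted⁻ ≺-isStrictTotalOrder b∙a)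
    where open ClosureInv σ τ

  ⁺⇒Inv-∨ : TransClosure (Inv σ ∪ Inv τ) ⇒ Inv (σ ∨ₛ τ)
  ⁺⇒Inv-∨ t = R⁺⇒< t , sorted⁺ ≺-isStrictTotalOrder (inj₂ t)
    where open ClosureInv σ τ

  -- The meet is sorted by the reverse of `_≺_`, so the pairs of the closure become non-inversions
  -- rather than inversions.
  Ninv-∧⇒⁺ : Ninv (σ ∧ₛ τ) ⇒ TransClosure (Ninv σ ∪ Ninv τ)
  Ninv-∧⇒⁺ (a<b , a∙b) = ≺⇒R⁺ a<b (sorted⁻ ≻-isStrictTotalOrder a∙b)
    where open ClosureNinv σ τ

  ⁺⇒Ninv-∧ : TransClosure (Ninv σ ∪ Ninv τ) ⇒ Ninv (σ ∧ₛ τ)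
  ⁺⇒Ninv-∧ t = R⁺⇒< t , sorted⁺ ≻-isStrictTotalOrder (inj₂ t)
    where open ClosureNinv σ τ

  module _ (e : End) {X : Subset n} where

    Shrinks-Inv-∨ : Shrinks e X (Inv σ) → Shrinks e X (Inv τ) → Shrinks e X (Inv (σ ∨ₛ τ))
    Shrinks-Inv-∨ f g = Shrinks-resp e ⁺⇒Inv-∨ Inv-∨⇒⁺ (Shrinks-⁺ e (Shrinks-∪ e f g))

    Shrinks-Ninv-∧ : Shrinks e X (Ninv σ) → Shrinks e X (Ninv τ) → Shrinks e X (Ninv (σ ∧ₛ τ))
    Shrinks-Ninv-∧ f g = Shrinks-resp e ⁺⇒Ninv-∧ Ninv-∧⇒⁺ (Shrinks-⁺ e (Shrinks-∪ e f g))

    -- Here the closure is the complement `Inv (σ ∨ₛ τ)`: the hypotheses become lengthening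
    -- conditions on `Inv σ` and `Inv τ`, pass through the closure, and are turned back.
    Shrinks-Ninv-∨ : Shrinks e X (Ninv σ) → Shrinks e X (Ninv τ) → Shrinks e X (Ninv (σ ∨ₛ τ))
    Shrinks-Ninv-∨ f g = Grows⇒Shrinks e (Inv-Ninv-complementary (σ ∨ₛ τ))
      (Grows-resp e ⁺⇒Inv-∨ Inv-∨⇒⁺ (Grows-⁺ e [ proj₁ , proj₁ ]′ (Grows-∪ e
        (Shrinks⇒Grows e (Ninv-Inv-complementary σ) f)
        (Shrinks⇒Grows e (Ninv-Inv-complementary τ) g))))

    Shrinks-Inv-∧ : Shrinks e X (Inv σ) → Shrinks e X (Inv τ) → Shrinks e X (Inv (σ ∧ₛ τ))
    Shrinks-Inv-∧ f g = Grows⇒Shrinks e (Ninv-Inv-complementary (σ ∧ₛ τ))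
      (Grows-resp e ⁺⇒Ninv-∧ Ninv-∧⇒⁺ (Grows-⁺ e [ proj₁ , proj₁ ]′ (Grows-∪ e
        (Shrinks⇒Grows e (Inv-Ninv-complementary σ) f)
        (Shrinks⇒Grows e (Inv-Ninv-complementary τ) g))))

-- Endpoint conditions as sublattices.

bottom top : WOIP n → Permutation′ n
bottom (_ , σ , _)  = σ
top (_ , _ , σ′ , _) = σ′

-- Meets and joins are computed endpointwise: `top (P ∧ Q)` reduces to `top P ∧ₛ top Q`, and
-- likewise for joins.
ShrinksTop-sublattice : ∀ e (X : Subset n) →
  InducesSublattice (WOIP-lattice n) (λ P → Shrinks e X (Ninv (top P)))
ShrinksTop-sublattice e X P Q f g =
  Shrinks-Ninv-∧ (top P) (top Q) e f g , Shrinks-Ninv-∨ (top P) (top Q) e f g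

ShrinksBottom-sublattice : ∀ e (X : Subset n) →
  InducesSublattice (WOIP-lattice n) (λ P → Shrinks e X (Inv (bottom P)))
ShrinksBottom-sublattice e X P Q f g =
  Shrinks-Inv-∧ (bottom P) (bottom Q) e f g , Shrinks-Inv-∨ (bottom P) (bottom Q) e f g

module _ {c ℓ₁ ℓ₂ ℓ ℓ′} (L : Lattice c ℓ₁ ℓ₂)
         {A : Pred (Lattice.Carrier L) ℓ} {B : Pred (Lattice.Carrier L) ℓ′} where

  InducesSublattice-∩ : InducesSublattice L A → InducesSublattice L B →
                        InducesSublattice L (A ∩ B)
  InducesSublattice-∩ f g x y (ax , bx) (ay , by) =
    let (a∧ , a∨) = f x y ax ay
        (b∧ , b∨) = g x y bx by
    in (a∧ , b∧) , (a∨ , b∨)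

  InducesSublattice-resp : (∀ x → A x ⇔ B x) → InducesSublattice L A → InducesSublattice L B
  InducesSublattice-resp A⇔B f x y bx by =
    let (a∧ , a∨) = f x y (from (A⇔B x) bx) (from (A⇔B y) by)
    in to (A⇔B _) a∧ , to (A⇔B _) a∨

-- Relations and extremal linear extensions of an interval poset.

module _ (P : WOIP n) where

  private
    p  = proj₁ P
    σ  = bottom P
    σ′ = top P
    σ≼σ′ : σ ≼ₛ σ′
    σ≼σ′ = proj₁ (proj₂ (proj₂ (proj₂ P)))
    p≈ : p ≈ ◁[ σ , σ′ ]
    p≈ = proj₂ (proj₂ (proj₂ (proj₂ P)))

  ◁⇒Ninv : ∀ {a b} → a < b → p ⊢ a ◁ b → Ninv σ′ a b
  ◁⇒Ninv {a} {b} a<b r = a<b , strict σ′ (<⇒≢ a<b) (proj₂ (to (p≈ a b) r))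

  -- Since `σ ≼ₛ σ′`, a non-inversion of `σ′` is also one of `σ`, so both total orders contain the
  -- pair.
  Ninv⇒◁ : ∀ {a b} → Ninv σ′ a b → p ⊢ a ◁ b
  Ninv⇒◁ {a} {b} i = from (p≈ a b)
    (ℕ.<⇒≤ (proj₂ (≼ₛ⇒Ninv σ σ′ σ≼σ′ i)) , ℕ.<⇒≤ (proj₂ i))

  ▷⇒Inv : ∀ {a b} → a < b → p ⊢ a ▷ b → Inv σ a b
  ▷⇒Inv {a} {b} a<b r = a<b , strict σ (<⇒≢ a<b ∘ sym) (proj₁ (to (p≈ b a) r))

  Inv⇒▷ : ∀ {a b} → Inv σ a b → p ⊢ a ▷ b
  Inv⇒▷ {a} {b} i = from (p≈ b a) (ℕ.<⇒≤ (proj₂ i) , ℕ.<⇒≤ (proj₂ (σ≼σ′ i)))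

  -- Each non-inversion of `σ′` is a relation of `p`, hence a non-inversion of every linear
  -- extension, and containment of non-inversions reverses the weak order.
  top-maximal : IsMaximalLinearExtension p σ′
  top-maximal = (λ a b r → proj₂ (to (p≈ a b) r)) , λ τ ext →
    Ninv⇒≼ₛ τ σ′ λ i → proj₁ i , strict τ (<⇒≢ (proj₁ i)) (ext _ _ (Ninv⇒◁ i))

  bottom-minimal : IsMinimalLinearExtension p σ
  bottom-minimal = (λ a b r → proj₁ (to (p≈ a b) r)) , λ τ ext i →
    proj₁ i , strict τ (<⇒≢ (proj₁ i) ∘ sym) (ext _ _ (Inv⇒▷ i))

  module _ (𝕆 : Orientation n) where

    ShrinksTop⇔IPIP⁺ : Shrinks left (𝕆⁺ 𝕆) (Ninv σ′) ⇔ IPIP⁺ 𝕆 p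
    ShrinksTop⇔IPIP⁺ = mk⇔
      (λ f a b c a<b b<c b∈ → Ninv⇒◁ ∘ f a b c a<b b<c b∈ ∘ ◁⇒Ninv (<-trans a<b b<c))
      (λ f a b c a<b b<c b∈ → ◁⇒Ninv a<b ∘ f a b c a<b b<c b∈ ∘ Ninv⇒◁)

    ShrinksTop⇔IPIP⁻ : Shrinks right (𝕆⁻ 𝕆) (Ninv σ′) ⇔ IPIP⁻ 𝕆 p
    ShrinksTop⇔IPIP⁻ = mk⇔
      (λ f a b c a<b b<c b∈ → Ninv⇒◁ ∘ f a b c a<b b<c b∈ ∘ ◁⇒Ninv (<-trans a<b b<c))
      (λ f a b c a<b b<c b∈ → ◁⇒Ninv b<c ∘ f a b c a<b b<c b∈ ∘ Ninv⇒◁)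

    ShrinksBottom⇔DPIP⁺ : Shrinks right (𝕆⁺ 𝕆) (Inv σ) ⇔ DPIP⁺ 𝕆 p
    ShrinksBottom⇔DPIP⁺ = mk⇔
      (λ f a b c a<b b<c b∈ → Inv⇒▷ ∘ f a b c a<b b<c b∈ ∘ ▷⇒Inv (<-trans a<b b<c))
      (λ f a b c a<b b<c b∈ → ▷⇒Inv b<c ∘ f a b c a<b b<c b∈ ∘ Inv⇒▷)

    ShrinksBottom⇔DPIP⁻ : Shrinks left (𝕆⁻ 𝕆) (Inv σ) ⇔ DPIP⁻ 𝕆 p
    ShrinksBottom⇔DPIP⁻ = mk⇔
      (λ f a b c a<b b<c b∈ → Inv⇒▷ ∘ f a b c a<b b<c b∈ ∘ ▷⇒Inv (<-trans a<b b<c))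
      (λ f a b c a<b b<c b∈ → ▷⇒Inv a<b ∘ f a b c a<b b<c b∈ ∘ Inv⇒▷)

    -- The forbidden patterns `b a c` and `a c b` are exactly the failures to shorten the
    -- non-inversion `(a , c)` with the left or the right end fixed.
    ShrinksTop⇔IPIP∅ :
      (Shrinks left (𝕆⁺ 𝕆) (Ninv σ′) × Shrinks right (𝕆⁻ 𝕆) (Ninv σ′)) ⇔ IPIP∅ 𝕆 p
    ShrinksTop⇔IPIP∅ = mk⇔
      (λ (f , g) → σ′ , top-maximal
        , (λ a b c a<b b<c b∈ (b∙a , a∙c) →
            <-asym b∙a (proj₂ (f a b c a<b b<c b∈ (<-trans a<b b<c , a∙c))))
        , (λ a b c a<b b<c b∈ (a∙c , c∙b) →
            <-asym c∙b (proj₂ (g a b c a<b b<c b∈ (<-trans a<b b<c , a∙c)))))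
      from-avoiding
      where
      from-avoiding : IPIP∅ 𝕆 p →
        Shrinks left (𝕆⁺ 𝕆) (Ninv σ′) × Shrinks right (𝕆⁻ 𝕆) (Ninv σ′)
      from-avoiding (ρ , (ρ-ext , ρ-max) , avoid⁺ , avoid⁻) =
          Shrinks-resp left ρ⇒σ′ σ′⇒ρ shrinks⁺ , Shrinks-resp right ρ⇒σ′ σ′⇒ρ shrinks⁻
        where
        -- Both `ρ` and `σ′` are greatest linear extensions, so each dominates the other and their
        -- non-inversions agree.
        ρ⇒σ′ : Ninv ρ ⇒ Ninv σ′
        ρ⇒σ′ = ≼ₛ⇒Ninv σ′ ρ (ρ-max σ′ (proj₁ top-maximal))
        σ′⇒ρ : Ninv σ′ ⇒ Ninv ρ
        σ′⇒ρ = ≼ₛ⇒Ninv ρ σ′ (proj₂ top-maximal ρ ρ-ext)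
        shrinks⁺ : Shrinks left (𝕆⁺ 𝕆) (Ninv ρ)
        shrinks⁺ a b c a<b b<c b∈ (_ , a∙c) with precedes-total ρ (<⇒≢ a<b)
        ... | inj₁ a∙b = a<b , a∙b
        ... | inj₂ b∙a = contradiction (b∙a , a∙c) (avoid⁺ a b c a<b b<c b∈)
        shrinks⁻ : Shrinks right (𝕆⁻ 𝕆) (Ninv ρ)
        shrinks⁻ a b c a<b b<c b∈ (_ , a∙c) with precedes-total ρ (<⇒≢ b<c)
        ... | inj₁ b∙c = b<c , b∙c
        ... | inj₂ c∙b = contradiction (a∙c , c∙b) (avoid⁻ a b c a<b b<c b∈)

    -- The patterns `b c a` and `c a b` are failures to shorten the inversion `(a , c)`; now `𝕆⁺`
    -- goes with the fixed right end and `𝕆⁻` with the left.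
    ShrinksBottom⇔DPIP∅ :
      (Shrinks right (𝕆⁺ 𝕆) (Inv σ) × Shrinks left (𝕆⁻ 𝕆) (Inv σ)) ⇔ DPIP∅ 𝕆 p
    ShrinksBottom⇔DPIP∅ = mk⇔
      (λ (f , g) → σ , bottom-minimal
        , (λ a b c a<b b<c b∈ (b∙c , c∙a) →
            <-asym b∙c (proj₂ (f a b c a<b b<c b∈ (<-trans a<b b<c , c∙a))))
        , (λ a b c a<b b<c b∈ (c∙a , a∙b) →
            <-asym a∙b (proj₂ (g a b c a<b b<c b∈ (<-trans a<b b<c , c∙a)))))
      from-avoiding
      where
      from-avoiding : DPIP∅ 𝕆 p →
        Shrinks right (𝕆⁺ 𝕆) (Inv σ) × Shrinks left (𝕆⁻ 𝕆) (Inv σ)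
      from-avoiding (ρ , (ρ-ext , ρ-min) , avoid⁺ , avoid⁻) =
          Shrinks-resp right ρ⇒σ σ⇒ρ shrinks⁺ , Shrinks-resp left ρ⇒σ σ⇒ρ shrinks⁻
        where
        ρ⇒σ : Inv ρ ⇒ Inv σ
        ρ⇒σ = ρ-min σ (proj₁ bottom-minimal)
        σ⇒ρ : Inv σ ⇒ Inv ρ
        σ⇒ρ = proj₂ bottom-minimal ρ ρ-ext
        shrinks⁺ : Shrinks right (𝕆⁺ 𝕆) (Inv ρ)
        shrinks⁺ a b c a<b b<c b∈ (_ , c∙a) with precedes-total ρ (<⇒≢ b<c)
        ... | inj₁ b∙c = contradiction (b∙c , c∙a) (avoid⁺ a b c a<b b<c b∈)
        ... | inj₂ c∙b = b<c , c∙b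
        shrinks⁻ : Shrinks left (𝕆⁻ 𝕆) (Inv ρ)
        shrinks⁻ a b c a<b b<c b∈ (_ , c∙a) with precedes-total ρ (<⇒≢ a<b)
        ... | inj₁ a∙b = contradiction (c∙a , a∙b) (avoid⁻ a b c a<b b<c b∈)
        ... | inj₂ b∙a = a<b , b∙a

-- Sublattices for each sign.

module _ (𝕆 : Orientation n) where

  private
    L = WOIP-lattice n

  IPIP⁺-sublattice : InducesSublattice L (IPIP⁺ 𝕆 ∘ proj₁)
  IPIP⁺-sublattice = InducesSublattice-resp L (λ P → ShrinksTop⇔IPIP⁺ P 𝕆)
    (ShrinksTop-sublattice left (𝕆⁺ 𝕆))

  IPIP⁻-sublattice : InducesSublattice L (IPIP⁻ 𝕆 ∘ proj₁)
  IPIP⁻-sublattice = InducesSublattice-resp L (λ P → ShrinksTop⇔IPIP⁻ P 𝕆)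
    (ShrinksTop-sublattice right (𝕆⁻ 𝕆))

  DPIP⁺-sublattice : InducesSublattice L (DPIP⁺ 𝕆 ∘ proj₁)
  DPIP⁺-sublattice = InducesSublattice-resp L (λ P → ShrinksBottom⇔DPIP⁺ P 𝕆)
    (ShrinksBottom-sublattice right (𝕆⁺ 𝕆))

  DPIP⁻-sublattice : InducesSublattice L (DPIP⁻ 𝕆 ∘ proj₁)
  DPIP⁻-sublattice = InducesSublattice-resp L (λ P → ShrinksBottom⇔DPIP⁻ P 𝕆)
    (ShrinksBottom-sublattice left (𝕆⁻ 𝕆))

  IPIP-sublattice : ∀ ε → InducesSublattice L (IPIP ε 𝕆 ∘ proj₁)
  -- `IPIP∅` matches the conjunction of the two top conditions, so these are intersected before the
  -- transfer.
  IPIP-sublattice ∅ˢ = InducesSublattice-resp L (λ P → ShrinksTop⇔IPIP∅ P 𝕆)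
    (InducesSublattice-∩ L
      (ShrinksTop-sublattice left (𝕆⁺ 𝕆)) (ShrinksTop-sublattice right (𝕆⁻ 𝕆)))
  IPIP-sublattice −ˢ = IPIP⁻-sublattice
  IPIP-sublattice +ˢ = IPIP⁺-sublattice
  IPIP-sublattice ±ˢ = InducesSublattice-∩ L IPIP⁺-sublattice IPIP⁻-sublattice

  DPIP-sublattice : ∀ ε → InducesSublattice L (DPIP ε 𝕆 ∘ proj₁)
  DPIP-sublattice ∅ˢ = InducesSublattice-resp L (λ P → ShrinksBottom⇔DPIP∅ P 𝕆)
    (InducesSublattice-∩ L
      (ShrinksBottom-sublattice right (𝕆⁺ 𝕆)) (ShrinksBottom-sublattice left (𝕆⁻ 𝕆)))
  DPIP-sublattice −ˢ = DPIP⁻-sublattice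
  DPIP-sublattice +ˢ = DPIP⁺-sublattice
  DPIP-sublattice ±ˢ = InducesSublattice-∩ L DPIP⁺-sublattice DPIP⁻-sublattice

theorem87 : ∀ (n : ℕ) (𝕆 : Orientation n) (ε : Sign) →
    InducesSublattice (WOIP-lattice n) (IPIP ε 𝕆 ∘ proj₁)
    × InducesSublattice (WOIP-lattice n) (DPIP ε 𝕆 ∘ proj₁)
theorem87 n 𝕆 ε = IPIP-sublattice 𝕆 ε , DPIP-sublattice 𝕆 ε
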